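{- For every integer $r\ge 2$, the generalised H-graph $H^5(r)$ satisfies $\chi_\rho(H^5(r))=6$.
   Context: All graphs are simple; $d_G(u,v)$ is the shortest-path distance. A packing $k$-colouring of $G$ is a map $\pi:V(G)\to\{1,\dots,k\}$ such that for distinct $u,v$, $\pi(u)=\pi(v)=i$ implies $d_G(u,v)>i$; $\chi_\rho(G)$ is the least $k$ for which a packing $k$-colouring exists. For integers $r\ge 2$ and $\ell\ge 1$, the generalised H-graph $H^\ell(r)$ has vertex set $\{u^i_j: 0\le i\le \ell+1,\ 0\le j\le 2r-1\}$ and edge set consisting of: $u^0_ju^0_{j+1}$ and $u^{\ell+1}_ju^{\ell+1}_{j+1}$ for $0\le j\le 2r-1$ (subscripts modulo $2r$); $u^i_{2j}u^i_{2j+1}$ for $1\le i\le \ell$, $0\le j\le r-1$; and $u^i_ju^{i+1}_j$ for $0\le i\le \ell$, $0\le j\le 2r-1$. -}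

module Defs where

open import Data.Nat using (ℕ; zero; suc; _+_; _*_; _≤_; _<_)
open import Data.Fin using (Fin; toℕ)
open import Data.Product using (Σ; ∃; _×_; _,_)
open import Data.Sum using (_⊎_)
open import Relation.Nullary using (¬_)
open import Relation.Binary.PropositionalEquality using (_≡_; _≢_)

record Graph : Set₁ where
  field
    V   : Set
    Adj : V → V → Set
open Graph public

data Walk (G : Graph) : V G → V G → ℕ → Set where
  here : ∀ {u} → Walk G u u zero
  step : ∀ {u w v n} → Adj G u w → Walk G w v n → Walk G u v (suc n)

DistLe : (G : Graph) → V G → V G → ℕ → Set
DistLe G u v k = Σ ℕ λ m → m ≤ k × Walk G u v m

-- d_G(u,v) > k  (includes d_G(u,v) = ∞)
DistGt : (G : Graph) → V G → V G → ℕ → Set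
DistGt G u v k = ¬ DistLe G u v k

IsPackingColouring : (G : Graph) → ℕ → (V G → ℕ) → Set
IsPackingColouring G k π =
  (∀ v → 1 ≤ π v × π v ≤ k) ×
  (∀ u v → u ≢ v → π u ≡ π v → DistGt G u v (π u))

HasPackingColouring : Graph → ℕ → Set
HasPackingColouring G k = Σ (V G → ℕ) λ π → IsPackingColouring G k π

PackingChromaticNumberIs : Graph → ℕ → Set
PackingChromaticNumberIs G k =
  HasPackingColouring G k × (∀ k′ → k′ < k → ¬ HasPackingColouring G k′)

-- Generalised H-graph H^ℓ(r): vertex u^i_j is (i , j), i ∈ {0..ℓ+1}, j ∈ {0..2r-1}.
HVertex : ℕ → ℕ → Set
HVertex ℓ r = Fin (suc (suc ℓ)) × Fin (2 * r)

SuccMod : ℕ → ℕ → ℕ → Set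
SuccMod r j j′ = (j′ ≡ suc j) ⊎ (suc j ≡ 2 * r × j′ ≡ 0)

data HEdge (ℓ r : ℕ) : HVertex ℓ r → HVertex ℓ r → Set where
  cycle : ∀ i j j′ → (toℕ i ≡ 0 ⊎ toℕ i ≡ suc ℓ) →
          SuccMod r (toℕ j) (toℕ j′) → HEdge ℓ r (i , j) (i , j′)
  rung  : ∀ i j j′ → 1 ≤ toℕ i → toℕ i ≤ ℓ → (m : ℕ) →
          toℕ j ≡ 2 * m → toℕ j′ ≡ suc (2 * m) → HEdge ℓ r (i , j) (i , j′)
  vert  : ∀ i i′ j → toℕ i′ ≡ suc (toℕ i) → HEdge ℓ r (i , j) (i′ , j)

H : ℕ → ℕ → Graph
H ℓ r = record { V = HVertex ℓ r ; Adj = λ u v → HEdge ℓ r u v ⊎ HEdge ℓ r v u }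

{-# OPTIONS --safe #-}
module Submission where

-- H^5(r) is a cyclic chain of r ladders with 7 rungs, consecutive ladders being joined through the
-- top and the bottom row only. Lower bound: exhaustive search shows that three consecutive ladders
-- (the whole graph H^5(2) when r = 2) have no packing 5-colouring. Upper bound: cyclic words over
-- a 4-block and a 3-block of coloured ladders can be concatenated freely, which covers every r
-- except 2 and 5; these have blocks of their own. A walk of length at most 6 lifts to nine
-- consecutive ladders, so only finitely many nine-letter words have to be checked.

open import Defs
open import Data.Bool using (Bool; true; false; not; _∧_; _∨_; if_then_else_; T)
import Data.Bool as Bool
open import Data.Bool.ListAction using (all; any)
open import Data.Bool.Properties using (T-∧; T-∨; T?; not-involutive)
open import Data.Empty using (⊥-elim)
open import Data.Fin using (Fin; zero; suc; toℕ; fromℕ<; inject₁)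
import Data.Fin as Fin
open import Data.Fin.Patterns
open import Data.Fin.Properties using (toℕ-injective; toℕ<n; toℕ-fromℕ<; toℕ-inject₁)
import Data.Fin.Properties as Fin
open import Data.List using (List; []; _∷_; _++_; map; concatMap; allFin; null)
open import Data.List.Membership.Propositional using (_∈_)
import Data.List.Membership.DecPropositional as DecMembership
open import Data.List.Membership.Propositional.Properties
  using (∈-map⁺; ∈-map⁻; ∈-++⁺ˡ; ∈-++⁺ʳ; ∈-++⁻; ∈-allFin)
import Data.List.Relation.Unary.All as All
open import Data.List.Relation.Unary.All.Properties using (all⁺)
open import Data.List.Relation.Unary.Any using (Any; here; there)
open import Data.List.Relation.Unary.Any.Properties using (any⁻)
open import Data.Nat using (ℕ; zero; suc; _+_; _*_; _≤_; _<_; z≤n; s≤s; _≤?_; _≤ᵇ_; _≡ᵇ_)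
open import Data.Nat.Properties
open import Data.Product using (∃; ∃-syntax; _×_; _,_; proj₁; proj₂; map₁)
open import Data.Product.Properties using (≡-dec)
open import Data.Sum using (_⊎_; inj₁; inj₂; swap)
open import Data.Unit using (tt)
open import Data.Vec as Vec using (Vec; []; _∷_; lookup)
open import Data.Vec.Properties using (lookup-map)
open import Function using (_∘_; id)
open import Function.Bundles using (Equivalence)
open import Relation.Binary.Definitions using (DecidableEquality)
open import Relation.Binary.PropositionalEquality
open import Relation.Nullary using (¬_; yes; no; does; contradiction)
open import Relation.Nullary.Decidable using (toWitness; _⊎-dec_; _→-dec_; from-yes)

-- Boolean reflection and monotonicity in the bounds.

∧⁻ : ∀ {x y} → T (x ∧ y) → T x × T y
∧⁻ = Equivalence.to T-∧

∨⁻ : ∀ {x y} → T (x ∨ y) → T x ⊎ T y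
∨⁻ = Equivalence.to T-∨

all-∈ : ∀ {A : Set} (p : A → Bool) {xs x} → T (all p xs) → x ∈ xs → T (p x)
all-∈ p {xs} h = All.lookup (all⁺ p xs h)

all≡true : ∀ {A : Set} (P : A → Bool) xs {x} → all P xs ≡ true → x ∈ xs → T (P x)
all≡true P xs eq = all-∈ P (subst T (sym eq) tt)

DistLe-mono : ∀ {G u v k l} → k ≤ l → DistLe G u v k → DistLe G u v l
DistLe-mono k≤l (m , m≤k , walk) = m , ≤-trans m≤k k≤l , walk

HasPackingColouring-mono : ∀ {G k l} → k ≤ l → HasPackingColouring G k → HasPackingColouring G l
HasPackingColouring-mono k≤l (π , range , apart) =
  π , (λ v → proj₁ (range v) , ≤-trans (proj₂ (range v)) k≤l) , apart

-- Exhaustive search for packing 5-colourings.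

module Refutation {X : Set} (_≟_ : DecidableEquality X) (nbrs : X → List X) where

  within : ℕ → X → X → Bool
  within zero    x y = does (x ≟ y)
  within (suc k) x y = does (x ≟ y) ∨ any (λ z → within k z y) (nbrs x)

  gapFrom : ℕ → ℕ → X → X → ℕ
  gapFrom zero    k x y = k
  gapFrom (suc f) k x y = if within k x y then k else gapFrom f (suc k) x y

  -- The distance from x to y, except that 6 stands both for "more than 5" and for x = y.
  gap : X → X → ℕ
  gap x y = if does (x ≟ y) then 6 else gapFrom 5 1 x y

  clash : ℕ → List ℕ → List ℕ → Bool
  clash c (d ∷ ds) (a ∷ as) = (a ≡ᵇ c) ∧ (d ≤ᵇ c) ∨ clash c ds as
  clash c _        _        = false

  -- Row k of the table holds the gaps from the k-th vertex to its predecessors, latest first,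
  -- in the order in which dead stacks their colours.
  table : List X → List X → List (List ℕ)
  table seen []       = []
  table seen (x ∷ xs) = map (gap x) seen ∷ table (x ∷ seen) xs

  palette : List ℕ
  palette = 1 ∷ 2 ∷ 3 ∷ 4 ∷ 5 ∷ []

  -- Backtracking search: `as` is a partial colouring, latest vertex first, and a branch dies when
  -- each colour of the next vertex clashes or leads to a dead branch. A completed colouring
  -- survives, hence `false` on the empty table.
  dead : List ℕ → List (List ℕ) → Bool
  dead as []          = false
  dead as (ds ∷ rows) = all (λ c → clash c ds as ∨ dead (c ∷ as) rows) palette

  -- An injective homomorphism suffices: distances in `G` are at most those in `X`, so every clash
  -- found in `X` is a genuine one in `G`.
  module _ (G : Graph) (f : X → V G)
           (f-adj : ∀ {x y} → y ∈ nbrs x → Adj G (f x) (f y))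
           (f-inj : ∀ {x y} → f x ≡ f y → x ≡ y) where

    within⇒DistLe : ∀ k x y → T (within k x y) → DistLe G (f x) (f y) k
    within⇒DistLe zero x y h with yes refl ← x ≟ y = 0 , z≤n , here
    within⇒DistLe (suc k) x y h with x ≟ y
    ... | yes refl = 0 , z≤n , here
    ... | no _ = go (any⁻ _ (nbrs x) h) id
      where
      -- `sub` remembers that the remaining list lies in `nbrs x`, as `f-adj` requires.
      go : ∀ {zs} → Any (λ z → T (within k z y)) zs → (∀ {z} → z ∈ zs → z ∈ nbrs x) →
           DistLe G (f x) (f y) (suc k)
      go (here {x = z} w) sub with m , m≤k , walk ← within⇒DistLe k z y w =
        suc m , s≤s m≤k , step (f-adj (sub (here refl))) walk
      go (there ws) sub = go ws (sub ∘ there)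

    -- The sum `g + k` is constant along the recursion and is the value returned when the fuel runs
    -- out, so a smaller result comes from a successful `within`.
    gapFrom⇒DistLe : ∀ g k {c} x y → gapFrom g k x y ≤ c → c < g + k → DistLe G (f x) (f y) c
    gapFrom⇒DistLe zero k x y k≤c c<k = contradiction k≤c (<⇒≱ c<k)
    gapFrom⇒DistLe (suc g) k {c} x y gap≤c c<g+k with within k x y in eq
    ... | true  = DistLe-mono gap≤c (within⇒DistLe k x y (subst T (sym eq) tt))
    ... | false = gapFrom⇒DistLe g (suc k) x y gap≤c (subst (c <_) (sym (+-suc g k)) c<g+k)

    gap⇒DistLe : ∀ {c} x y → c ≤ 5 → gap x y ≤ c → x ≢ y × DistLe G (f x) (f y) c
    gap⇒DistLe {c} x y c≤5 = go (x ≟ y)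
      where
      go : ∀ x≟y → (if does x≟y then 6 else gapFrom 5 1 x y) ≤ c → x ≢ y × DistLe G (f x) (f y) c
      go (yes _)  6≤c   = contradiction (≤-trans 6≤c c≤5) (<⇒≱ ≤-refl)
      go (no x≢y) gap≤c = x≢y , gapFrom⇒DistLe 5 1 x y gap≤c (s≤s c≤5)

    ∈-palette : ∀ {c} → 1 ≤ c → c ≤ 5 → c ∈ palette
    ∈-palette {1} _ _ = here refl
    ∈-palette {2} _ _ = there (here refl)
    ∈-palette {3} _ _ = there (there (here refl))
    ∈-palette {4} _ _ = there (there (there (here refl)))
    ∈-palette {5} _ _ = there (there (there (there (here refl))))
    ∈-palette {suc (suc (suc (suc (suc (suc _)))))} _ (s≤s (s≤s (s≤s (s≤s (s≤s ())))))

    module _ (π : V G → ℕ) (packing : IsPackingColouring G 5 π) where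

      range : ∀ v → 1 ≤ π v × π v ≤ 5
      range = proj₁ packing

      apart : ∀ u v → u ≢ v → π u ≡ π v → DistGt G u v (π u)
      apart = proj₂ packing

      κ : X → ℕ
      κ x = π (f x)

      no-clash : ∀ x ys → ¬ T (clash (κ x) (map (gap x) ys) (map κ ys))
      no-clash x (y ∷ ys) h with ∨⁻ h
      ... | inj₂ h′ = no-clash x ys h′
      ... | inj₁ h′ with same , close ← ∧⁻ {x = κ y ≡ᵇ κ x} h′
        with x≢y , near ← gap⇒DistLe x y (proj₂ (range (f x))) (≤ᵇ⇒≤ _ _ close) =
        apart (f x) (f y) (x≢y ∘ f-inj) (sym (≡ᵇ⇒≡ _ _ same)) near

      -- A packing colouring selects a branch that cannot die: at each vertex follow the colour
      -- `κ x`, which never clashes.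
      not-dead : ∀ seen xs → ¬ T (dead (map κ seen) (table seen xs))
      not-dead seen (x ∷ xs) h
        with ∨⁻ (all-∈ (λ c → clash c (map (gap x) seen) (map κ seen) ∨
                              dead (c ∷ map κ seen) (table (x ∷ seen) xs))
                       h (∈-palette (proj₁ (range (f x))) (proj₂ (range (f x)))))
      ... | inj₁ h′ = no-clash x seen h′
      ... | inj₂ h′ = not-dead (x ∷ seen) xs h′

    refute : ∀ xs → T (dead [] (table [] xs)) → ¬ HasPackingColouring G 5
    refute xs h (π , packing) = not-dead π packing [] xs h

-- Columns as pairs of ladder and side.

-- Columns 2m and 2m+1 of H 5 r form the ladder m; decode sends them to (m , false) and (m , true).
decode : ℕ → ℕ × Bool
decode 0             = 0 , false
decode 1             = 0 , true
decode (suc (suc j)) = map₁ suc (decode j)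

encode : ℕ × Bool → ℕ
encode (m , false) = 2 * m
encode (m , true)  = suc (2 * m)

bump : ℕ × Bool → ℕ × Bool
bump (m , false) = m , true
bump (m , true)  = suc m , false

decode-suc : ∀ j → decode (suc j) ≡ bump (decode j)
decode-suc 0 = refl
decode-suc 1 = refl
decode-suc (suc (suc j)) rewrite decode-suc j with decode j
... | _ , false = refl
... | _ , true  = refl

encode-bump : ∀ c → encode (bump c) ≡ suc (encode c)
encode-bump (m , false) = refl
encode-bump (m , true)  = *-suc 2 m

encode-decode : ∀ j → encode (decode j) ≡ j
encode-decode zero = refl
encode-decode (suc j) =
  trans (cong encode (decode-suc j)) (trans (encode-bump (decode j)) (cong suc (encode-decode j)))

decode-2* : ∀ m → decode (2 * m) ≡ (m , false)
decode-2* zero = refl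
decode-2* (suc m) rewrite *-suc 2 m | decode-2* m = refl

decode-encode : ∀ c → decode (encode c) ≡ c
decode-encode (m , false) = decode-2* m
decode-encode (m , true)  = trans (decode-suc (2 * m)) (cong bump (decode-2* m))

encode-< : ∀ {m r} s → m < r → encode (m , s) < 2 * r
encode-< {m} {r} s m<r = <-≤-trans (below s) (≤-trans (≤-reflexive (sym (*-suc 2 m))) (*-monoʳ-≤ 2 m<r))
  where
  below : ∀ s → encode (m , s) < 2 + 2 * m
  below false = m≤n⇒m≤1+n ≤-refl
  below true  = ≤-refl

decode-< : ∀ {j r} → j < 2 * r → proj₁ (decode j) < r
decode-< {j} {r} j<2r = *-cancelˡ-< 2 _ _
  (≤-<-trans (below (decode j)) (subst (_< 2 * r) (sym (encode-decode j)) j<2r))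
  where
  below : ∀ c → 2 * proj₁ c ≤ encode c
  below (m , false) = ≤-refl
  below (m , true)  = m≤n⇒m≤1+n ≤-refl

-- The seven rows.

rowNbrs : Fin 7 → List (Fin 7)
rowNbrs 0F = 1F ∷ []
rowNbrs 1F = 0F ∷ 2F ∷ []
rowNbrs 2F = 1F ∷ 3F ∷ []
rowNbrs 3F = 2F ∷ 4F ∷ []
rowNbrs 4F = 3F ∷ 5F ∷ []
rowNbrs 5F = 4F ∷ 6F ∷ []
rowNbrs 6F = 5F ∷ []

RowAdj : Fin 7 → Fin 7 → Set
RowAdj i k = toℕ k ≡ suc (toℕ i) ⊎ toℕ i ≡ suc (toℕ k)

open DecMembership (Fin._≟_ {7}) using (_∈?_)

rowNbrs-sound : ∀ i k → k ∈ rowNbrs i → RowAdj i k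
rowNbrs-sound = from-yes (Fin.all? λ i → Fin.all? λ k →
  (k ∈? rowNbrs i) →-dec ((toℕ k ≟ suc (toℕ i)) ⊎-dec (toℕ i ≟ suc (toℕ k))))

rowNbrs-complete : ∀ i k → RowAdj i k → k ∈ rowNbrs i
rowNbrs-complete = from-yes (Fin.all? λ i → Fin.all? λ k →
  ((toℕ k ≟ suc (toℕ i)) ⊎-dec (toℕ i ≟ suc (toℕ k))) →-dec (k ∈? rowNbrs i))

isEnd : Fin 7 → Bool
isEnd 0F = true
isEnd 6F = true
isEnd _  = false

isEnd-sound : ∀ i → T (isEnd i) → toℕ i ≡ 0 ⊎ toℕ i ≡ 6
isEnd-sound 0F _ = inj₁ refl
isEnd-sound 6F _ = inj₂ refl

isEnd-complete : ∀ i → toℕ i ≡ 0 ⊎ toℕ i ≡ 6 → T (isEnd i)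
isEnd-complete = from-yes (Fin.all? λ i →
  ((toℕ i ≟ 0) ⊎-dec (toℕ i ≟ 6)) →-dec T? (isEnd i))

-- The cyclic order of the ladders.

-- Ladder m′ follows ladder m in the cyclic order.
Next : ℕ → ℕ → ℕ → Set
Next r m m′ = m′ < r × (m′ ≡ suc m ⊎ (suc m ≡ r × m′ ≡ 0))

-- Together with `Next-injective`, this identifies the target of an arbitrary step of `H 5 r` with
-- the neighbour listed in a strip.
Next-functional : ∀ {r m m′ m″} → Next r m m′ → Next r m m″ → m′ ≡ m″
Next-functional (_ , inj₁ refl) (_ , inj₁ refl) = refl
Next-functional (_ , inj₂ (_ , refl)) (_ , inj₂ (_ , refl)) = refl
Next-functional (m<r , inj₁ refl) (_ , inj₂ (refl , _)) = contradiction m<r (<-irrefl refl)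
Next-functional (_ , inj₂ (refl , _)) (m<r , inj₁ refl) = contradiction m<r (<-irrefl refl)

Next-injective : ∀ {r m m′ m″} → Next r m m″ → Next r m′ m″ → m ≡ m′
Next-injective (_ , inj₁ refl) (_ , inj₁ refl) = refl
Next-injective (_ , inj₂ (refl , _)) (_ , inj₂ (eq , _)) = suc-injective (sym eq)
Next-injective (_ , inj₁ refl) (_ , inj₂ (_ , ()))
Next-injective (_ , inj₂ (_ , refl)) (_ , inj₁ ())

next-exists : ∀ {r m} → m < r → ∃ (Next r m)
next-exists {r} {m} m<r with m≤n⇒m<n∨m≡n m<r
... | inj₁ sm<r = suc m , sm<r , inj₁ refl
... | inj₂ sm≡r = 0 , ≤-<-trans z≤n m<r , inj₂ (sm≡r , refl)

prev-exists : ∀ {r m} → m < r → ∃[ m′ ] m′ < r × Next r m′ m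
prev-exists {suc r} {zero}  0<r = r , ≤-refl , 0<r , inj₂ (refl , refl)
prev-exists {r}     {suc m} m<r = m , <-trans ≤-refl m<r , m<r , inj₁ refl

-- Adjacency in coordinates.

Coord : Set
Coord = Fin 7 × ℕ × Bool

coord : ∀ r → V (H 5 r) → Coord
coord r (i , j) = i , decode (toℕ j)

coord-injective : ∀ {r} {u v : V (H 5 r)} → coord r u ≡ coord r v → u ≡ v
coord-injective {u = i , j} {v = i′ , j′} eq =
  cong₂ _,_ (cong proj₁ eq)
    (toℕ-injective (trans (sym (encode-decode (toℕ j)))
                          (trans (cong (encode ∘ proj₂) eq) (encode-decode (toℕ j′)))))

-- Adjacency of H 5 r in coordinates (row, ladder, side).
data Step (r : ℕ) : Coord → Coord → Set where
  across : ∀ {i m s s′} → s′ ≡ not s → Step r (i , m , s) (i , m , s′)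
  along  : ∀ {i k m s} → k ∈ rowNbrs i → Step r (i , m , s) (k , m , s)
  right  : ∀ {i m m′} → T (isEnd i) → Next r m m′ → Step r (i , m , true) (i , m′ , false)
  left   : ∀ {i m m′} → T (isEnd i) → Next r m m′ → Step r (i , m′ , false) (i , m , true)

Step-sym : ∀ {r u v} → Step r u v → Step r v u
Step-sym (across refl) = across (sym (not-involutive _))
Step-sym (along {i} {k} k∈) = along (rowNbrs-complete k i (swap (rowNbrs-sound i k k∈)))
Step-sym (right e n) = left e n
Step-sym (left e n) = right e n

-- In an end row, a cycle edge leaving an even column is a rung of its ladder, and one leaving an
-- odd column passes to the next ladder.
HEdge⇒Step : ∀ {r u v} → HEdge 5 r u v → Step r (coord r u) (coord r v)
HEdge⇒Step (rung i j j′ _ _ m eq eq′)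
  rewrite eq | eq′ | decode-encode (m , false) | decode-encode (m , true) = across refl
HEdge⇒Step (vert i k j eq) = along (rowNbrs-complete i k (inj₁ eq))
HEdge⇒Step {r} (cycle i j j′ end (inj₁ eq)) =
  subst (λ c → Step r (i , decode (toℕ j)) (i , c)) (sym decode-j′)
        (go (decode (toℕ j)) (subst (λ c → proj₁ c < r) decode-j′ (decode-< (toℕ<n j′))))
  where
  decode-j′ : decode (toℕ j′) ≡ bump (decode (toℕ j))
  decode-j′ = trans (cong decode eq) (decode-suc (toℕ j))
  go : ∀ c → proj₁ (bump c) < r → Step r (i , c) (i , bump c)
  go (m , false) _    = across refl
  go (m , true)  sm<r = right (isEnd-complete i end) (sm<r , inj₁ refl)
HEdge⇒Step {r} (cycle i j j′ end (inj₂ (eq , eq′))) rewrite eq′ =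
  go (decode (toℕ j)) (trans (sym (decode-suc (toℕ j))) (trans (cong decode eq) (decode-2* r)))
  where
  go : ∀ c → bump c ≡ (r , false) → Step r (i , c) (i , 0 , false)
  -- Only the right side of the last ladder bumps to `(r , false)`, so `r` becomes `suc m` and the
  -- step wraps to ladder 0.
  go (m , true) refl = right (isEnd-complete i end) (s≤s z≤n , inj₂ (refl , refl))

Adj⇒Step : ∀ {r u v} → Adj (H 5 r) u v → Step r (coord r u) (coord r v)
Adj⇒Step (inj₁ e) = HEdge⇒Step e
Adj⇒Step (inj₂ e) = Step-sym (HEdge⇒Step e)

-- Rows 0 and 6 have no `rung` edges; there the rung is a cycle edge.
ladder-rung : ∀ {r} i {j j′ : Fin (2 * r)} m → toℕ j ≡ 2 * m → toℕ j′ ≡ suc (2 * m) →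
              HEdge 5 r (i , j) (i , j′)
ladder-rung 0F m eq eq′ = cycle 0F _ _ (inj₁ refl) (inj₁ (trans eq′ (cong suc (sym eq))))
ladder-rung 6F m eq eq′ = cycle 6F _ _ (inj₂ refl) (inj₁ (trans eq′ (cong suc (sym eq))))
ladder-rung 1F m = rung 1F _ _ (toWitness {a? = 1 ≤? 1} _) (toWitness {a? = 1 ≤? 5} _) m
ladder-rung 2F m = rung 2F _ _ (toWitness {a? = 1 ≤? 2} _) (toWitness {a? = 2 ≤? 5} _) m
ladder-rung 3F m = rung 3F _ _ (toWitness {a? = 1 ≤? 3} _) (toWitness {a? = 3 ≤? 5} _) m
ladder-rung 4F m = rung 4F _ _ (toWitness {a? = 1 ≤? 4} _) (toWitness {a? = 4 ≤? 5} _) m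
ladder-rung 5F m = rung 5F _ _ (toWitness {a? = 1 ≤? 5} _) (toWitness {a? = 5 ≤? 5} _) m

Next⇒HEdge : ∀ {r m m′} i {j j′ : Fin (2 * r)} → T (isEnd i) → Next r m m′ →
             toℕ j ≡ suc (2 * m) → toℕ j′ ≡ 2 * m′ → HEdge 5 r (i , j) (i , j′)
Next⇒HEdge {m = m} i end (_ , inj₁ refl) eq eq′ =
  cycle i _ _ (isEnd-sound i end) (inj₁ (trans eq′ (trans (*-suc 2 m) (cong suc (sym eq)))))
Next⇒HEdge {m = m} i end (_ , inj₂ (refl , refl)) eq eq′ =
  cycle i _ _ (isEnd-sound i end) (inj₂ (trans (cong suc eq) (sym (*-suc 2 m)) , eq′))

Step⇒Adj : ∀ {r i c k d} {j j′ : Fin (2 * r)} → Step r (i , c) (k , d) →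
           toℕ j ≡ encode c → toℕ j′ ≡ encode d → Adj (H 5 r) (i , j) (k , j′)
Step⇒Adj {i = i} (across {m = m} {s = false} refl) eq eq′ = inj₁ (ladder-rung i m eq eq′)
Step⇒Adj {i = i} (across {m = m} {s = true}  refl) eq eq′ = inj₂ (ladder-rung i m eq′ eq)
Step⇒Adj {i = i} {k = k} (along k∈) eq eq′ with toℕ-injective (trans eq (sym eq′)) | rowNbrs-sound i k k∈
... | refl | inj₁ e = inj₁ (vert i k _ e)
... | refl | inj₂ e = inj₂ (vert k i _ e)
Step⇒Adj {i = i} (right e n) eq eq′ = inj₁ (Next⇒HEdge i e n eq eq′)
Step⇒Adj {i = i} (left e n) eq eq′ = inj₂ (Next⇒HEdge i e n eq′ eq)

-- Strips of ladders and their maps into the graph.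

Cell : ℕ → Set
Cell n = Fin 7 × Fin n × Bool

_≟ᶜ_ : ∀ {n} → DecidableEquality (Cell n)
_≟ᶜ_ = ≡-dec Fin._≟_ (≡-dec Fin._≟_ Bool._≟_)

-- This is the order of the search: ladder by ladder and row by row, so that conflicts between
-- nearby cells show up early.
cells : ∀ n → List (Cell n)
cells n = concatMap (λ p → concatMap (λ i → (i , p , false) ∷ (i , p , true) ∷ []) (allFin 7)) (allFin n)

-- Lists of following and preceding ladders cover both a path, where they are empty at the ends, and
-- the closed cycle of two ladders.
module Strip {n : ℕ} (nexts prevs : Fin n → List (Fin n)) where

  sideways : Cell n → List (Cell n)
  sideways (i , p , true)  = map (λ q → i , q , false) (nexts p)
  sideways (i , p , false) = map (λ q → i , q , true) (prevs p)

  nbrs : Cell n → List (Cell n)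
  nbrs c@(i , p , s) =
    (i , p , not s) ∷ map (λ k → k , p , s) (rowNbrs i) ++ (if isEnd i then sideways c else [])

  inside : Fin n → Bool
  inside p = not (null (nexts p)) ∧ not (null (prevs p))

  -- The map `w` may repeat values: for small `r` a window of nine ladders winds around the cycle.
  module Embedded {r : ℕ} (w : Fin n → ℕ)
                  (nexts-Next : ∀ p {q} → q ∈ nexts p → Next r (w p) (w q))
                  (prevs-Next : ∀ p {q} → q ∈ prevs p → Next r (w q) (w p)) where

    place : Cell n → Coord
    place (i , p , s) = i , w p , s

    sideways-sound : ∀ c {d} → T (isEnd (proj₁ c)) → d ∈ sideways c → Step r (place c) (place d)
    sideways-sound (i , p , true) e d∈ with ∈-map⁻ _ d∈
    ... | q , q∈ , refl = right e (nexts-Next p q∈)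
    sideways-sound (i , p , false) e d∈ with ∈-map⁻ _ d∈
    ... | q , q∈ , refl = left e (prevs-Next p q∈)

    nbrs-sound : ∀ c {d} → d ∈ nbrs c → Step r (place c) (place d)
    nbrs-sound (i , p , s) (here refl) = across refl
    nbrs-sound c@(i , p , s) (there d∈) with ∈-++⁻ (map _ (rowNbrs i)) d∈
    ... | inj₁ d∈ˡ with k , k∈ , refl ← ∈-map⁻ _ d∈ˡ = along k∈
    ... | inj₂ d∈ʳ with isEnd i in eq
    ...   | true = sideways-sound c (subst T (sym eq) tt) d∈ʳ

    nonempty : ∀ {A : Set} (xs : List A) → T (not (null xs)) → ∃ (_∈ xs)
    nonempty (x ∷ _) _ = x , here refl

    sideways-∈ : ∀ c {d} → T (isEnd (proj₁ c)) → d ∈ sideways c → d ∈ nbrs c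
    sideways-∈ c@(i , _ , _) e d∈ with isEnd i
    ... | true = there (∈-++⁺ʳ (map _ (rowNbrs i)) d∈)

    -- Local lifting, as for a covering map: where both neighbouring ladders are present, uniqueness
    -- of the next and of the previous ladder forces every step into the strip.
    nbrs-complete : ∀ c {v} → T (inside (proj₁ (proj₂ c))) → Step r (place c) v →
                    ∃[ d ] d ∈ nbrs c × v ≡ place d
    nbrs-complete (i , p , s) _ (across refl) = _ , here refl , refl
    nbrs-complete (i , p , s) _ (along k∈) = _ , there (∈-++⁺ˡ (∈-map⁺ _ k∈)) , refl
    nbrs-complete c@(i , p , true) ins (right e n) with nonempty (nexts p) (proj₁ (∧⁻ ins))
    ... | q , q∈ = _ , sideways-∈ c e (∈-map⁺ _ q∈) ,
                   cong (λ m → i , m , false) (Next-functional n (nexts-Next p q∈))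
    nbrs-complete c@(i , p , false) ins (left e n)
      with nonempty (prevs p) (proj₂ (∧⁻ {not (null (nexts p))} ins))
    ... | q , q∈ = _ , sideways-∈ c e (∈-map⁺ _ q∈) ,
                   cong (λ m → i , m , true) (Next-injective n (prevs-Next p q∈))

next : ∀ {k} → Fin (suc k) → List (Fin (suc k))
next {zero}  zero    = []
next {suc k} zero    = 1F ∷ []
next {suc k} (suc p) = map suc (next p)

prev : ∀ {k} → Fin k → List (Fin k)
prev zero    = []
prev (suc p) = inject₁ p ∷ []

next⁻ : ∀ {k} (p : Fin (suc k)) {q} → q ∈ next p → ∃[ t ] p ≡ inject₁ t × q ≡ suc t
next⁻ {suc k} zero    (here refl) = zero , refl , refl
next⁻ {suc k} (suc p) q∈ with q , q∈′ , refl ← ∈-map⁻ suc q∈ with t , refl , refl ← next⁻ p q∈′ =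
  suc t , refl , refl

module Path {r k : ℕ} (w : Fin (suc k) → ℕ) (w-Next : ∀ t → Next r (w (inject₁ t)) (w (suc t))) where

  next-Next : ∀ p {q} → q ∈ next p → Next r (w p) (w q)
  next-Next p q∈ with t , refl , refl ← next⁻ p q∈ = w-Next t

  prev-Next : ∀ p {q} → q ∈ prev p → Next r (w q) (w p)
  prev-Next (suc t) (here refl) = w-Next t

-- The lower bound.

module Ladders (r : ℕ) {n : ℕ} (n≤r : n ≤ r) (nexts prevs : Fin n → List (Fin n))
               (nexts-Next : ∀ p {q} → q ∈ nexts p → Next r (toℕ p) (toℕ q))
               (prevs-Next : ∀ p {q} → q ∈ prevs p → Next r (toℕ q) (toℕ p)) where

  open Strip nexts prevs
  open Embedded {r} toℕ nexts-Next prevs-Next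
  open Refutation _≟ᶜ_ nbrs

  column : Fin n → Bool → Fin (2 * r)
  column p s = fromℕ< (encode-< s (<-≤-trans (toℕ<n p) n≤r))

  toℕ-column : ∀ p s → toℕ (column p s) ≡ encode (toℕ p , s)
  toℕ-column p s = toℕ-fromℕ< _

  vertex : Cell n → V (H 5 r)
  vertex (i , p , s) = i , column p s

  vertex-injective : ∀ {c d} → vertex c ≡ vertex d → c ≡ d
  vertex-injective {i , p , s} {k , q , t} eq =
    cong₂ _,_ (cong proj₁ eq) (cong₂ _,_ (toℕ-injective (cong proj₁ same)) (cong proj₂ same))
    where
    same : (toℕ p , s) ≡ (toℕ q , t)
    same = trans (sym (decode-encode (toℕ p , s)))
          (trans (cong decode (trans (sym (toℕ-column p s))
                              (trans (cong (toℕ ∘ proj₂) eq) (toℕ-column q t))))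
                 (decode-encode (toℕ q , t)))

  vertex-adj : ∀ {c d} → d ∈ nbrs c → Adj (H 5 r) (vertex c) (vertex d)
  vertex-adj {i , p , s} {k , q , t} d∈ = Step⇒Adj (nbrs-sound _ d∈) (toℕ-column p s) (toℕ-column q t)

  unpackable : dead [] (table [] (cells n)) ≡ true → ¬ HasPackingColouring (H 5 r) 5
  unpackable h = refute (H 5 r) vertex vertex-adj vertex-injective (cells n) (subst T (sym h) tt)

other : Fin 2 → List (Fin 2)
other 0F = 1F ∷ []
other 1F = 0F ∷ []

-- The two ladders are each other's next and previous, so the strip is closed up; `refl` runs the
-- search over all 28 vertices.
lower₂ : ¬ HasPackingColouring (H 5 2) 5
lower₂ = Ladders.unpackable 2 ≤-refl other other forth back refl
  where
  forth : ∀ p {q} → q ∈ other p → Next 2 (toℕ p) (toℕ q)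
  forth 0F (here refl) = s≤s (s≤s z≤n) , inj₁ refl
  forth 1F (here refl) = s≤s z≤n , inj₂ (refl , refl)
  back : ∀ p {q} → q ∈ other p → Next 2 (toℕ q) (toℕ p)
  back 0F (here refl) = s≤s z≤n , inj₂ (refl , refl)
  back 1F (here refl) = s≤s (s≤s z≤n) , inj₁ refl

-- One search over the 42 cells of an open strip serves all these `r`: edges outside the strip, such
-- as the wrap when `r` is 3, can only shorten distances.
lower₃ : ∀ r → 3 ≤ r → ¬ HasPackingColouring (H 5 r) 5
lower₃ r 3≤r = Ladders.unpackable r 3≤r next prev next-Next prev-Next refl
  where
  open Path {r} {2} toℕ
    (λ t → <-≤-trans (s≤s (toℕ<n t)) 3≤r , inj₁ (cong suc (sym (toℕ-inject₁ t))))

lower : ∀ r → 2 ≤ r → ¬ HasPackingColouring (H 5 r) 5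
lower 2 _ = lower₂
lower r@(suc (suc (suc _))) _ = lower₃ r (s≤s (s≤s (s≤s z≤n)))
lower 1 (s≤s ())

-- Coloured ladders and the words formed from them.

data Tile : Set where
  B₄ : Fin 4 → Tile
  B₃ : Fin 3 → Tile
  B₂ : Fin 2 → Tile
  B₅ : Fin 5 → Tile

tiles : List Tile
tiles = map B₄ (allFin 4) ++ map B₃ (allFin 3) ++ map B₂ (allFin 2) ++ map B₅ (allFin 5)

∈-tiles : ∀ x → x ∈ tiles
∈-tiles (B₄ k) = ∈-++⁺ˡ (∈-map⁺ B₄ (∈-allFin k))
∈-tiles (B₃ k) = ∈-++⁺ʳ (map B₄ (allFin 4)) (∈-++⁺ˡ (∈-map⁺ B₃ (∈-allFin k)))
∈-tiles (B₂ k) =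
  ∈-++⁺ʳ (map B₄ (allFin 4)) (∈-++⁺ʳ (map B₃ (allFin 3)) (∈-++⁺ˡ (∈-map⁺ B₂ (∈-allFin k))))
∈-tiles (B₅ k) =
  ∈-++⁺ʳ (map B₄ (allFin 4)) (∈-++⁺ʳ (map B₃ (allFin 3)) (∈-++⁺ʳ (map B₂ (allFin 2)) (∈-map⁺ B₅ (∈-allFin k))))

-- The colours of columns 2m and 2m+1, row by row; the four blocks were found by computer search.
paint : Tile → Vec (ℕ × ℕ) 7
paint (B₄ 0F) = (4 , 1) ∷ (2 , 3) ∷ (5 , 1) ∷ (1 , 2) ∷ (6 , 1) ∷ (1 , 3) ∷ (2 , 1) ∷ []
paint (B₄ 1F) = (2 , 1) ∷ (1 , 3) ∷ (6 , 1) ∷ (1 , 4) ∷ (3 , 1) ∷ (1 , 2) ∷ (5 , 1) ∷ []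
paint (B₄ 2F) = (5 , 1) ∷ (1 , 2) ∷ (4 , 1) ∷ (1 , 3) ∷ (6 , 1) ∷ (1 , 2) ∷ (3 , 1) ∷ []
paint (B₄ 3F) = (3 , 1) ∷ (1 , 2) ∷ (6 , 1) ∷ (1 , 5) ∷ (2 , 1) ∷ (1 , 3) ∷ (4 , 1) ∷ []
paint (B₃ 0F) = (4 , 1) ∷ (1 , 3) ∷ (5 , 1) ∷ (1 , 2) ∷ (6 , 1) ∷ (1 , 3) ∷ (2 , 1) ∷ []
paint (B₃ 1F) = (2 , 1) ∷ (1 , 5) ∷ (3 , 2) ∷ (4 , 1) ∷ (2 , 6) ∷ (1 , 3) ∷ (5 , 1) ∷ []
paint (B₃ 2F) = (3 , 1) ∷ (1 , 2) ∷ (6 , 1) ∷ (1 , 5) ∷ (2 , 1) ∷ (1 , 3) ∷ (4 , 1) ∷ []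
paint (B₂ 0F) = (3 , 1) ∷ (1 , 4) ∷ (2 , 1) ∷ (1 , 6) ∷ (3 , 1) ∷ (1 , 5) ∷ (2 , 1) ∷ []
paint (B₂ 1F) = (2 , 1) ∷ (1 , 5) ∷ (3 , 1) ∷ (1 , 6) ∷ (2 , 1) ∷ (1 , 4) ∷ (3 , 1) ∷ []
paint (B₅ 0F) = (6 , 1) ∷ (1 , 4) ∷ (2 , 3) ∷ (5 , 1) ∷ (1 , 2) ∷ (4 , 1) ∷ (1 , 3) ∷ []
paint (B₅ 1F) = (2 , 5) ∷ (3 , 1) ∷ (1 , 2) ∷ (4 , 1) ∷ (1 , 3) ∷ (5 , 1) ∷ (1 , 2) ∷ []
paint (B₅ 2F) = (1 , 2) ∷ (3 , 1) ∷ (1 , 6) ∷ (2 , 1) ∷ (1 , 5) ∷ (3 , 2) ∷ (1 , 4) ∷ []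
paint (B₅ 3F) = (1 , 3) ∷ (4 , 1) ∷ (1 , 2) ∷ (3 , 1) ∷ (1 , 5) ∷ (2 , 1) ∷ (1 , 3) ∷ []
paint (B₅ 4F) = (1 , 2) ∷ (5 , 1) ∷ (1 , 4) ∷ (2 , 1) ∷ (1 , 3) ∷ (6 , 1) ∷ (1 , 2) ∷ []

-- The tiles allowed immediately before a tile: the words are the concatenations of B₄ and B₃,
-- the repetitions of B₂ and the repetitions of B₅.
preds : Tile → List Tile
preds (B₄ 0F)      = B₄ 3F ∷ B₃ 2F ∷ []
preds (B₄ (suc k)) = B₄ (inject₁ k) ∷ []
preds (B₃ 0F)      = B₄ 3F ∷ B₃ 2F ∷ []
preds (B₃ (suc k)) = B₃ (inject₁ k) ∷ []
preds (B₂ 0F)      = B₂ 1F ∷ []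
preds (B₂ 1F)      = B₂ 0F ∷ []
preds (B₅ 0F)      = B₅ 4F ∷ []
preds (B₅ (suc k)) = B₅ (inject₁ k) ∷ []

colour : Tile → Fin 7 → Bool → ℕ
colour x i false = proj₁ (lookup (paint x) i)
colour x i true  = proj₂ (lookup (paint x) i)

-- The finite check of nine-letter words.

open Strip {9} next prev

module Window (κ : Cell 9 → ℕ) (c₀ : Cell 9) where

  -- Cells are compared, not vertices: for small `r` several cells lie over one vertex, and a second
  -- cell over the vertex of `c₀` is rejected as well.
  ok : Cell 9 → Bool
  ok c = not (κ c ≡ᵇ κ c₀) ∨ does (c ≟ᶜ c₀)

  -- inside makes the check fail on walks that might leave the nine ladders.
  safe : ℕ → Cell 9 → Bool
  safe zero    c = ok c
  safe (suc k) c = ok c ∧ inside (proj₁ (proj₂ c)) ∧ all (safe k) (nbrs c)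

  valid : Bool
  valid = (1 ≤ᵇ κ c₀) ∧ (κ c₀ ≤ᵇ 6) ∧ safe (κ c₀) c₀

record Valid (κ : Cell 9 → ℕ) (c₀ : Cell 9) : Set where
  constructor mkValid
  open Window κ c₀
  field
    lo    : 1 ≤ κ c₀
    hi    : κ c₀ ≤ 6
    guard : T (safe (κ c₀) c₀)

valid⇒Valid : ∀ κ c₀ → T (Window.valid κ c₀) → Valid κ c₀
valid⇒Valid κ c₀ h =
  let lo , rest = ∧⁻ {1 ≤ᵇ κ c₀} h
      hi , guard = ∧⁻ {κ c₀ ≤ᵇ 6} rest
  in mkValid (≤ᵇ⇒≤ 1 _ lo) (≤ᵇ⇒≤ _ 6 hi) guard

shade : Vec Tile 9 → Cell 9 → ℕ
shade xs (i , k , s) = colour (lookup xs k) i s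

-- Only the central ladder `4F` is tested. Two moves to the same side need a step across between
-- them, so six steps reach at most three ladders away; the fourth ladder on each side keeps those
-- reached `inside`.
goodWindow : Vec Tile 9 → Bool
goodWindow xs =
  all (λ i → all (λ s → Window.valid (shade xs) (i , 4F , s)) (false ∷ true ∷ [])) (allFin 7)

-- Words grow to the left, since `preds` tells what may stand before a tile. Eight extensions of a
-- last tile give all admissible nine-letter words.
every : ℕ → (List Tile → Bool) → List Tile → Bool
every zero    P xs       = P xs
every (suc k) P []       = true
every (suc k) P (x ∷ xs) = all (λ y → every k P (y ∷ x ∷ xs)) (preds x)

window : List Tile → Bool
window (x₀ ∷ x₁ ∷ x₂ ∷ x₃ ∷ x₄ ∷ x₅ ∷ x₆ ∷ x₇ ∷ x₈ ∷ []) =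
  goodWindow (x₀ ∷ x₁ ∷ x₂ ∷ x₃ ∷ x₄ ∷ x₅ ∷ x₆ ∷ x₇ ∷ x₈ ∷ [])
window _ = false

windowsTo : Tile → Bool
windowsTo x = every 8 window (x ∷ [])

-- Stated with ≡ true rather than T: Agda would evaluate the type T (…) afresh at every use.
windows-good : all windowsTo tiles ≡ true
windows-good = refl

Good : Vec Tile 9 → Set
Good xs = ∀ i s → Valid (shade xs) (i , 4F , s)

∈-sides : ∀ s → s ∈ false ∷ true ∷ []
∈-sides false = here refl
∈-sides true  = there (here refl)

goodWindow⇒Good : ∀ xs → T (goodWindow xs) → Good xs
goodWindow⇒Good xs h i s = valid⇒Valid (shade xs) _
  (all-∈ (λ s → Window.valid (shade xs) (i , 4F , s))
    (all-∈ (λ i → all (λ s → Window.valid (shade xs) (i , 4F , s)) (false ∷ true ∷ [])) h (∈-allFin i))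
    (∈-sides s))

module _ (P : List Tile → Bool) where

  every-step : ∀ k x xs {y} → T (every (suc k) P (x ∷ xs)) → y ∈ preds x → T (every k P (y ∷ x ∷ xs))
  every-step k x xs = all-∈ (λ y → every k P (y ∷ x ∷ xs))

  every-sound : ∀ {x₀ x₁ x₂ x₃ x₄ x₅ x₆ x₇ x₈} → T (every 8 P (x₈ ∷ [])) →
                x₀ ∈ preds x₁ → x₁ ∈ preds x₂ → x₂ ∈ preds x₃ → x₃ ∈ preds x₄ →
                x₄ ∈ preds x₅ → x₅ ∈ preds x₆ → x₆ ∈ preds x₇ → x₇ ∈ preds x₈ →
                T (P (x₀ ∷ x₁ ∷ x₂ ∷ x₃ ∷ x₄ ∷ x₅ ∷ x₆ ∷ x₇ ∷ x₈ ∷ []))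
  every-sound h e₀ e₁ e₂ e₃ e₄ e₅ e₆ e₇ =
    every-step 0 _ _ (every-step 1 _ _ (every-step 2 _ _ (every-step 3 _ _ (every-step 4 _ _
      (every-step 5 _ _ (every-step 6 _ _ (every-step 7 _ _ h e₇) e₆) e₅) e₄) e₃) e₂) e₁) e₀

windows-sound : ∀ {x₀ x₁ x₂ x₃ x₄ x₅ x₆ x₇ x₈} →
                x₀ ∈ preds x₁ → x₁ ∈ preds x₂ → x₂ ∈ preds x₃ → x₃ ∈ preds x₄ →
                x₄ ∈ preds x₅ → x₅ ∈ preds x₆ → x₆ ∈ preds x₇ → x₇ ∈ preds x₈ →
                Good (x₀ ∷ x₁ ∷ x₂ ∷ x₃ ∷ x₄ ∷ x₅ ∷ x₆ ∷ x₇ ∷ x₈ ∷ [])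
windows-sound {x₀} {x₁} {x₂} {x₃} {x₄} {x₅} {x₆} {x₇} {x₈} e₀ e₁ e₂ e₃ e₄ e₅ e₆ e₇ =
  goodWindow⇒Good (x₀ ∷ x₁ ∷ x₂ ∷ x₃ ∷ x₄ ∷ x₅ ∷ x₆ ∷ x₇ ∷ x₈ ∷ [])
    (every-sound window (all≡true windowsTo tiles windows-good (∈-tiles x₈))
      e₀ e₁ e₂ e₃ e₄ e₅ e₆ e₇)

-- From admissible cyclic words to packing colourings.

module Coloured (r : ℕ) (τ : ℕ → Tile) (τ-Next : ∀ {m m′} → Next r m m′ → τ m ∈ preds (τ m′)) where

  hue : Coord → ℕ
  hue (i , m , s) = colour (τ m) i s

  π : V (H 5 r) → ℕ
  π v = hue (coord r v)

  -- The window goes four ladders back and four forward in the cycle. Repetitions are allowed, so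
  -- small `r` is no exception.
  around : ∀ {m} → m < r → ∃[ ws ] lookup ws 4F ≡ m
         × (∀ t → Next r (lookup ws (inject₁ t)) (lookup ws (suc t)))
         × Good (Vec.map τ ws)
  around {w₄} <₄
    with w₃ , <₃ , n₃ ← prev-exists <₄
    with w₂ , <₂ , n₂ ← prev-exists <₃
    with w₁ , <₁ , n₁ ← prev-exists <₂
    with w₀ , _  , n₀ ← prev-exists <₁
    with w₅ , n₄ ← next-exists <₄
    with w₆ , n₅ ← next-exists (proj₁ n₄)
    with w₇ , n₆ ← next-exists (proj₁ n₅)
    with w₈ , n₇ ← next-exists (proj₁ n₆) =
    w₀ ∷ w₁ ∷ w₂ ∷ w₃ ∷ w₄ ∷ w₅ ∷ w₆ ∷ w₇ ∷ w₈ ∷ [] , refl ,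
    (λ { 0F → n₀ ; 1F → n₁ ; 2F → n₂ ; 3F → n₃ ; 4F → n₄ ; 5F → n₅ ; 6F → n₆ ; 7F → n₇ }) ,
    windows-sound (τ-Next n₀) (τ-Next n₁) (τ-Next n₂) (τ-Next n₃)
                  (τ-Next n₄) (τ-Next n₅) (τ-Next n₆) (τ-Next n₇)

  module Local (ws : Fin 9 → ℕ) (ws-Next : ∀ t → Next r (ws (inject₁ t)) (ws (suc t)))
               (κ : Cell 9 → ℕ) (c₀ : Cell 9) where

    open Path {r} {8} ws ws-Next
    open Embedded {r} ws next-Next prev-Next public
    open Window κ c₀

    safe⇒ok : ∀ k c → T (safe k c) → T (ok c)
    safe⇒ok zero    c h = h
    safe⇒ok (suc k) c h = proj₁ (∧⁻ {ok c} h)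

    -- The walk is lifted one step at a time: while `safe` has budget left, the current cell is
    -- `inside`, so `nbrs-complete` lifts the next step. Since `safe` tests `ok` at every stage,
    -- walks shorter than `k` are covered too.
    lift : ∀ {u v m} k c → coord r u ≡ place c → Walk (H 5 r) u v m → m ≤ k → T (safe k c) →
           ∃[ d ] coord r v ≡ place d × T (ok d)
    lift k c eq here m≤k h = c , eq , safe⇒ok k c h
    lift (suc k) c eq (step e walk) (s≤s m≤k) h
      with ins , nb ← ∧⁻ {inside (proj₁ (proj₂ c))} (proj₂ (∧⁻ {ok c} h))
      with d , d∈ , eq′ ← nbrs-complete c ins (subst (λ x → Step r x _) eq (Adj⇒Step e)) =
      lift k d eq′ walk m≤k (all-∈ (safe k) nb d∈)

    ok⇒≡ : ∀ d → κ d ≡ κ c₀ → T (ok d) → d ≡ c₀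
    ok⇒≡ d same h with ∨⁻ {not (κ d ≡ᵇ κ c₀)} h
    ... | inj₁ differ = ⊥-elim (T-not (≡⇒≡ᵇ _ _ same) differ)
      where
      T-not : ∀ {b} → T b → ¬ T (not b)
      T-not {true} _ ()
    ... | inj₂ h′ with yes eq ← d ≟ᶜ c₀ = eq

    module _ (κ-hue : ∀ c → κ c ≡ hue (place c)) (valid : Valid κ c₀)
             (u : V (H 5 r)) (home : coord r u ≡ place c₀) where

      open Valid valid

      π-κ : π u ≡ κ c₀
      π-κ = trans (cong hue home) (sym (κ-hue c₀))

      in-range : 1 ≤ π u × π u ≤ 6
      in-range = subst (1 ≤_) (sym π-κ) lo , subst (_≤ 6) (sym π-κ) hi

      -- A short walk to a vertex of the same colour lifts to one ending in a cell that `ok` forces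
      -- to be `c₀`, so the vertex is `u` itself.
      far : ∀ v → u ≢ v → π u ≡ π v → DistGt (H 5 r) u v (π u)
      far v u≢v same (m , m≤ , walk)
        with d , eq , okd ← lift (κ c₀) c₀ home walk (subst (m ≤_) π-κ m≤) guard
        with refl ← ok⇒≡ d (trans (κ-hue d) (trans (cong hue (sym eq)) (trans (sym same) π-κ))) okd =
        u≢v (coord-injective {r} (trans home (sym eq)))

  Fine : V (H 5 r) → Set
  Fine u = (1 ≤ π u × π u ≤ 6) × (∀ v → u ≢ v → π u ≡ π v → DistGt (H 5 r) u v (π u))

  fine : ∀ u → Fine u
  fine u@(i , j) = go (decode (toℕ j)) refl (around (decode-< (toℕ<n j)))
    where
    go : ∀ c → decode (toℕ j) ≡ c → ∃[ ws ] lookup ws 4F ≡ proj₁ c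
         × (∀ t → Next r (lookup ws (inject₁ t)) (lookup ws (suc t))) × Good (Vec.map τ ws) → Fine u
    go (m , s) eq (ws , centre , ws-Next , good) =
      in-range κ-hue (good i s) u home , far κ-hue (good i s) u home
      where
      open Local (lookup ws) ws-Next (shade (Vec.map τ ws)) (i , 4F , s)
      κ-hue : ∀ c → shade (Vec.map τ ws) c ≡ hue (place c)
      κ-hue (i , k , s) = cong (λ x → colour x i s) (lookup-map k τ ws)
      home : coord r u ≡ place (i , 4F , s)
      home = cong₂ (λ x y → i , x , y) (trans (cong proj₁ eq) (sym centre)) (cong proj₂ eq)

  packable : HasPackingColouring (H 5 r) 6
  packable = π , proj₁ ∘ fine , proj₂ ∘ fine

-- Words of every length and the upper bound.

module _ (ℓ : ℕ) (τ : ℕ → Tile) (τ-suc : ∀ m → τ m ∈ preds (τ (suc m)))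
         (τ-wrap : τ ℓ ∈ preds (τ 0)) where

  -- The infinite sequence is cut after `τ ℓ`, and `τ-wrap` closes it into a cycle of `suc ℓ`
  -- ladders.
  cyclic⇒packable : HasPackingColouring (H 5 (suc ℓ)) 6
  cyclic⇒packable = Coloured.packable (suc ℓ) τ λ where
    (_ , inj₁ refl)          → τ-suc _
    (_ , inj₂ (refl , refl)) → τ-wrap

-- One or two 4-blocks in front of the periodic 3-blocks shift the length to residue 1 or 2 modulo
-- 3.
seq₃ seq₄₃ seq₄₄₃ seq₂ seq₅ : ℕ → Tile

seq₃ 0 = B₃ 0F
seq₃ 1 = B₃ 1F
seq₃ 2 = B₃ 2F
seq₃ (suc (suc (suc n))) = seq₃ n

seq₄₃ 0 = B₄ 0F
seq₄₃ 1 = B₄ 1F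
seq₄₃ 2 = B₄ 2F
seq₄₃ 3 = B₄ 3F
seq₄₃ (suc (suc (suc (suc n)))) = seq₃ n

seq₄₄₃ 0 = B₄ 0F
seq₄₄₃ 1 = B₄ 1F
seq₄₄₃ 2 = B₄ 2F
seq₄₄₃ 3 = B₄ 3F
seq₄₄₃ (suc (suc (suc (suc n)))) = seq₄₃ n

seq₂ 0 = B₂ 0F
seq₂ 1 = B₂ 1F
seq₂ (suc (suc n)) = seq₂ n

seq₅ 0 = B₅ 0F
seq₅ 1 = B₅ 1F
seq₅ 2 = B₅ 2F
seq₅ 3 = B₅ 3F
seq₅ 4 = B₅ 4F
seq₅ (suc (suc (suc (suc (suc n))))) = seq₅ n

seq₃-suc : ∀ m → seq₃ m ∈ preds (seq₃ (suc m))
seq₃-suc 0 = here refl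
seq₃-suc 1 = here refl
seq₃-suc 2 = there (here refl)
seq₃-suc (suc (suc (suc m))) = seq₃-suc m

seq₄₃-suc : ∀ m → seq₄₃ m ∈ preds (seq₄₃ (suc m))
seq₄₃-suc 0 = here refl
seq₄₃-suc 1 = here refl
seq₄₃-suc 2 = here refl
seq₄₃-suc 3 = here refl
seq₄₃-suc (suc (suc (suc (suc m)))) = seq₃-suc m

seq₄₄₃-suc : ∀ m → seq₄₄₃ m ∈ preds (seq₄₄₃ (suc m))
seq₄₄₃-suc 0 = here refl
seq₄₄₃-suc 1 = here refl
seq₄₄₃-suc 2 = here refl
seq₄₄₃-suc 3 = here refl
seq₄₄₃-suc (suc (suc (suc (suc m)))) = seq₄₃-suc m

seq₂-suc : ∀ m → seq₂ m ∈ preds (seq₂ (suc m))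
seq₂-suc 0 = here refl
seq₂-suc 1 = here refl
seq₂-suc (suc (suc m)) = seq₂-suc m

seq₅-suc : ∀ m → seq₅ m ∈ preds (seq₅ (suc m))
seq₅-suc 0 = here refl
seq₅-suc 1 = here refl
seq₅-suc 2 = here refl
seq₅-suc 3 = here refl
seq₅-suc 4 = here refl
seq₅-suc (suc (suc (suc (suc (suc m))))) = seq₅-suc m

seq₃-last : ∀ n → seq₃ (2 + n * 3) ≡ B₃ 2F
seq₃-last zero    = refl
seq₃-last (suc n) = seq₃-last n

seq₃-wrap : ∀ n → seq₃ (2 + n * 3) ∈ preds (B₃ 0F)
seq₃-wrap n rewrite seq₃-last n = there (here refl)

-- The word ends in the 4-block when no 3-block follows, and in a 3-block otherwise; either may
-- precede `B₄ 0F`. This also closes `seq₄₄₃`, whose tail is `seq₄₃`.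
seq₄₃-wrap : ∀ n → seq₄₃ (3 + n * 3) ∈ preds (B₄ 0F)
seq₄₃-wrap zero = here refl
seq₄₃-wrap (suc n) rewrite seq₃-last n = there (here refl)

data Residue : ℕ → Set where
  +0 : ∀ k → Residue (k * 3)
  +1 : ∀ k → Residue (1 + k * 3)
  +2 : ∀ k → Residue (2 + k * 3)

residue : ∀ n → Residue n
residue zero = +0 0
residue (suc n) with residue n
... | +0 k = +1 k
... | +1 k = +2 k
... | +2 k = +0 (suc k)

-- The lengths split as 3(k+2), 4 + 3(k+1) and 4 + 4 + 3k.
upper-6+ : ∀ {n} → Residue n → HasPackingColouring (H 5 (6 + n)) 6
upper-6+ (+0 k) = cyclic⇒packable (5 + k * 3) seq₃ seq₃-suc (seq₃-wrap (suc k))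
upper-6+ (+1 k) = cyclic⇒packable (6 + k * 3) seq₄₃ seq₄₃-suc (seq₄₃-wrap (suc k))
upper-6+ (+2 k) = cyclic⇒packable (7 + k * 3) seq₄₄₃ seq₄₄₃-suc (seq₄₃-wrap k)

upper : ∀ r → 2 ≤ r → HasPackingColouring (H 5 r) 6
upper 2 _ = cyclic⇒packable 1 seq₂ seq₂-suc (here refl)
upper 3 _ = cyclic⇒packable 2 seq₃ seq₃-suc (seq₃-wrap 0)
upper 4 _ = cyclic⇒packable 3 seq₄₃ seq₄₃-suc (seq₄₃-wrap 0)
upper 5 _ = cyclic⇒packable 4 seq₅ seq₅-suc (here refl)
upper (suc (suc (suc (suc (suc (suc n)))))) _ = upper-6+ (residue n)
upper 1 (s≤s ())

theorem19 : (r : ℕ) → 2 ≤ r → PackingChromaticNumberIs (H 5 r) 6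
theorem19 r 2≤r =
  upper r 2≤r , λ { k (s≤s k≤5) col → lower r 2≤r (HasPackingColouring-mono k≤5 col) }
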